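{- Let $k\ge 1$ be an integer. If $X\subseteq A^*$ is regular, then $\underline{\mathcal{F}_k}(X)$ is a regular subset of $A^*$.
   Context: $A$ is a finite alphabet with $|A|\ge 2$; $A^*$ is the free monoid over $A$ and $|w|$ is the length of $w$. A subset of $A^*$ is regular if it is recognized by a finite automaton. For $w,w'\in A^*$, $(w,w')\in\mathcal{F}_k$ iff $|w|+|w'|-2|f|\le k$, where $f$ is a maximum length common factor (contiguous subword) of $w$ and $w'$. $\underline{\mathcal{F}_k}=\mathcal{F}_k\setminus\{(w,w):w\in A^*\}$. For a relation $\tau\subseteq A^*\times A^*$, $\tau(X)=\{y:\exists x\in X,\ (x,y)\in\tau\}$. -}

module Defs where

open import Level using (Level; _⊔_) renaming (suc to lsuc; zero to 0ℓ)
open import Data.Bool.Base using (Bool; T)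
open import Data.Fin.Base using (Fin)
open import Data.List.Base using (List; []; _∷_; length)
open import Data.List.Relation.Binary.Infix.Heterogeneous using (Infix)
open import Data.Nat.Base using (ℕ; _+_; _*_; _∸_; _≤_)
open import Data.Product.Base using (_×_; Σ-syntax; ∃-syntax)
open import Function.Bundles using (_↔_)
open import Relation.Binary.Core using (Rel)
open import Relation.Binary.PropositionalEquality.Core using (_≡_; _≢_)
open import Relation.Unary using (Pred; _≐_)

-- Nondeterministic, without ε-transitions, possibly with several initial
-- states.  The sets of initial states, final states and edges are finite
-- data, hence Boolean-valued.
record Automaton {a : Level} (A : Set a) : Set (a ⊔ lsuc 0ℓ) where
  field
    State   : Set
    size    : ℕ
    finite  : State ↔ Fin size
    initial : State → Bool
    final   : State → Bool
    edge    : State → A → State → Bool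

module _ {a : Level} {A : Set a} (M : Automaton A) where
  open Automaton M

  data Path : State → List A → State → Set a where
    []  : ∀ {p} → Path p [] p
    _∷_ : ∀ {p q r x w} → T (edge p x q) → Path q w r → Path p (x ∷ w) r

  Language : Pred (List A) a
  Language w = ∃[ p ] ∃[ q ] T (initial p) × Path p w q × T (final q)

module _ {a : Level} {A : Set a} where

  Regular : {ℓ : Level} → Pred (List A) ℓ → Set (a ⊔ ℓ ⊔ lsuc 0ℓ)
  Regular X = Σ[ M ∈ Automaton A ] X ≐ Language M

  Factor : Rel (List A) a
  Factor f w = Infix _≡_ f w

  CommonFactor : List A → List A → List A → Set a
  CommonFactor w w′ f = Factor f w × Factor f w′

  LongestCommonFactor : List A → List A → List A → Set a
  LongestCommonFactor w w′ f =
    CommonFactor w w′ f × (∀ g → CommonFactor w w′ g → length g ≤ length f)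

  -- The subtraction never truncates: a common factor is no longer than
  -- either word.  Its value is the same for every longest common factor,
  -- so the existential expresses "where f is a longest common factor".
  𝓕 : ℕ → Rel (List A) a
  𝓕 k w w′ = ∃[ f ] LongestCommonFactor w w′ f
                  × (length w + length w′) ∸ 2 * length f ≤ k

  -- 𝓕 k with the diagonal removed.
  𝓕̲ : ℕ → Rel (List A) a
  𝓕̲ k w w′ = 𝓕 k w w′ × w ≢ w′

  image : {ℓ₁ ℓ₂ : Level} → Rel (List A) ℓ₁ → Pred (List A) ℓ₂ →
          Pred (List A) (a ⊔ ℓ₁ ⊔ ℓ₂)
  image τ X y = ∃[ x ] X x × τ x y

{-# OPTIONS --safe #-}
module Submission where

-- A word y lies in the image iff it can be written p′ f s′ with p f s ∈ X,
-- p f s ≠ p′ f s′ and |p| + |s| + |p′| + |s′| ≤ k: any common factor f with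
-- this property may be replaced by a longest one.  There are finitely many
-- choices of p, s, p′, s′, and for each of them {f : p f s ∈ X} is a quotient of X
-- while {f : p f s = p′ f s′} is either empty or, up to exchanging both sides,
-- of the form {f : u f s = f s′}.  The latter is recognised by an automaton that
-- keeps a queue of length |u|, initially u: each letter read has to agree with
-- the head of the queue and is then appended to its end.

open import Defs
open import Level using (Level; _⊔_) renaming (zero to 0ℓ)
open import Data.Bool.Base using (Bool; true; false; T)
open import Data.Empty using (⊥-elim)
open import Data.Fin.Base using (Fin; zero; suc)
open import Data.Fin.Properties as Fin using (any?; *↔×; 2↔Bool)
open import Data.List.Base using (List; []; _∷_; _++_; _∷ʳ_; length)
open import Data.List.Properties as List
  using (∷-injective; ∷-injectiveˡ; ∷-injectiveʳ; length-++; ∷ʳ-++)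
open import Data.List.Relation.Binary.Infix.Heterogeneous using (here; there; MkView; toView; fromView)
open import Data.List.Relation.Binary.Infix.Heterogeneous.Properties using (infix?; length-mono)
open import Data.List.Relation.Binary.Pointwise using (Pointwise-≡⇒≡; ≡⇒Pointwise-≡)
open import Data.List.Relation.Binary.Prefix.Heterogeneous using (Prefix; []; _∷_)
open import Data.Nat.Base using (ℕ; zero; suc; _+_; _*_; _∸_; _^_; _≤_; z≤n; s≤s)
open import Data.Nat.Properties
  using (≤-trans; ≤-reflexive; ≰⇒>; ≤-pred; _≤?_; m≤m+n; m≤n+m;
         m+n∸n≡m; ∸-monoʳ-≤; *-monoʳ-≤; +-suc; +-identityʳ; +-monoˡ-≤)
open import Data.Nat.Solver using (module +-*-Solver)
open import Data.Product.Base using (_×_; _,_; proj₁; proj₂; ∃; ∃-syntax; Σ-syntax; uncurry)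
open import Data.Product.Function.NonDependent.Propositional using (_×-↔_)
open import Data.Sum.Base as Sum using (_⊎_; inj₁; inj₂)
open import Data.Vec.Base as Vec using (Vec; []; _∷_; lookup; tabulate; toList; fromList)
open import Data.Vec.Properties using (lookup∘tabulate; toList-∷ʳ; toList∘fromList)
open import Function.Base using (_∘_; id)
open import Function.Bundles using (_↔_; mk↔ₛ′; module Inverse)
open import Function.Construct.Composition using (_↔-∘_)
open import Function.Construct.Identity using (↔-id)
open import Function.Construct.Symmetry using (↔-sym)
open import Function.Properties.Inverse using (↔⇒↣)
open import Relation.Binary.Definitions using (DecidableEquality)
open import Relation.Binary.PropositionalEquality
  using (_≡_; _≢_; refl; sym; trans; cong; cong₂; subst)
open import Relation.Nullary using (¬_; Dec; yes; no; contradiction)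
open import Relation.Nullary.Decidable
  using (map′; _×-dec_; _⊎-dec_; ¬?; T?; isYes; toWitness; fromWitness)
open import Relation.Unary using (Pred; Decidable; _≐_)
open import Relation.Unary.Properties using (≐-trans)

private
  variable
    a b ℓ ℓ₁ ℓ₂ : Level
    A : Set a
    B : Set b
    m n : ℕ

-- Finite types

×-finite : A ↔ Fin m → B ↔ Fin n → (A × B) ↔ Fin (m * n)
×-finite A↔m B↔n = ↔-sym *↔× ↔-∘ (A↔m ×-↔ B↔n)

Vec-suc-↔ : Vec A (suc m) ↔ (A × Vec A m)
Vec-suc-↔ = mk↔ₛ′ (λ { (x ∷ xs) → x , xs }) (λ (x , xs) → x ∷ xs)
  (λ _ → refl) (λ { (_ ∷ _) → refl })

Vec-finite : A ↔ Fin n → ∀ m → Vec A m ↔ Fin (n ^ m)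
Vec-finite A↔n zero    = mk↔ₛ′ (λ _ → zero) (λ _ → []) (λ { zero → refl }) (λ { [] → refl })
Vec-finite A↔n (suc m) = ×-finite A↔n (Vec-finite A↔n m) ↔-∘ Vec-suc-↔

-- Deterministic automata

-- No initial state is fixed, so one automaton carries the whole family `Accepts D q`. Passing to a
-- left derivative only moves `q`, and this holds by computation.
record DFA (A : Set a) : Set a where
  field
    size  : ℕ
    δ     : Fin size → A → Fin size
    final : Fin size → Bool

module _ {A : Set a} (D : DFA A) where
  open DFA D

  Accepts : Fin size → Pred (List A) 0ℓ
  Accepts q []      = T (final q)
  Accepts q (x ∷ w) = Accepts (δ q x) w

  accepts? : ∀ q → Decidable (Accepts q)
  accepts? q []      = T? (final q)
  accepts? q (x ∷ w) = accepts? (δ q x) w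

Recognizable : {A : Set a} → Pred (List A) ℓ → Set (a ⊔ ℓ)
Recognizable {A = A} P = Σ[ D ∈ DFA A ] ∃[ q ] P ≐ Accepts D q

recognizable-≐ : {P : Pred (List A) ℓ₁} {Q : Pred (List A) ℓ₂} →
                 Q ≐ P → Recognizable P → Recognizable Q
recognizable-≐ Q≐P (D , q , P≐D) = D , q , ≐-trans Q≐P P≐D

-- A finite family of languages closed under left derivatives is recognised
-- by the automaton whose states are the indices of the family.
recognizable-family :
  {A : Set a} {S : Set b} → S ↔ Fin m → (L : S → Pred (List A) ℓ) (δ : S → A → S) →
  (∀ s → Dec (L s [])) → (∀ s x → (L s ∘ (x ∷_)) ≐ L (δ s x)) →
  ∀ s → Recognizable (L s)
recognizable-family {m = m} {A = A} {S = S} S↔m L δ nullable? derivative s =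
  D , to s , (λ {w} → sound w s) , (λ {w} → complete w s)
  where
  open Inverse S↔m

  D : DFA A
  D = record
    { size  = m
    ; δ     = λ i x → to (δ (from i) x)
    ; final = λ i → isYes (nullable? (from i))
    }

  δ-from-to : ∀ s x → to (δ (from (to s)) x) ≡ to (δ s x)
  δ-from-to s x = cong (λ s → to (δ s x)) (strictlyInverseʳ s)

  sound : ∀ w s → L s w → Accepts D (to s) w
  sound []      s l = fromWitness (subst (λ s → L s []) (sym (strictlyInverseʳ s)) l)
  sound (x ∷ w) s l = subst (λ i → Accepts D i w) (sym (δ-from-to s x))
    (sound w (δ s x) (proj₁ (derivative s x) l))

  complete : ∀ w s → Accepts D (to s) w → L s w
  complete []      s acc = subst (λ s → L s []) (strictlyInverseʳ s) (toWitness acc)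
  complete (x ∷ w) s acc = proj₂ (derivative s x)
    (complete w (δ s x) (subst (λ i → Accepts D i w) (δ-from-to s x) acc))

-- Boolean operations and quotients of recognizable languages

module _ {A : Set a} {P : Pred (List A) ℓ₁} {Q : Pred (List A) ℓ₂} where

  recognizable-× : Recognizable P → Recognizable Q → Recognizable (λ w → P w × Q w)
  recognizable-× (D , p , P⊆D , D⊆P) (E , q , Q⊆E , E⊆Q) =
    recognizable-≐
      ((λ (Pw , Qw) → P⊆D Pw , Q⊆E Qw) , (λ (Dw , Ew) → D⊆P Dw , E⊆Q Ew))
      (recognizable-family (×-finite (↔-id _) (↔-id _))
        (λ (p , q) w → Accepts D p w × Accepts E q w)
        (λ (p , q) x → DFA.δ D p x , DFA.δ E q x)
        (λ (p , q) → accepts? D p [] ×-dec accepts? E q [])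
        -- `Accepts` computes on `x ∷ w`, so both sides of the derivative condition are the same
        -- type.
        (λ _ _ → id , id) (p , q))

  recognizable-⊎ : Recognizable P → Recognizable Q → Recognizable (λ w → P w ⊎ Q w)
  recognizable-⊎ (D , p , P⊆D , D⊆P) (E , q , Q⊆E , E⊆Q) =
    recognizable-≐ (Sum.map P⊆D Q⊆E , Sum.map D⊆P E⊆Q)
      (recognizable-family (×-finite (↔-id _) (↔-id _))
        (λ (p , q) w → Accepts D p w ⊎ Accepts E q w)
        (λ (p , q) x → DFA.δ D p x , DFA.δ E q x)
        (λ (p , q) → accepts? D p [] ⊎-dec accepts? E q [])
        (λ _ _ → id , id) (p , q))

module _ {A : Set a} where

  recognizable-const : {P : Set ℓ} → Dec P → Recognizable {A = A} (λ _ → P)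
  recognizable-const {P = P} P? =
    recognizable-family (↔-id (Fin 1)) (λ _ _ → P) (λ s _ → s) (λ _ → P?) (λ _ _ → id , id) zero

module _ {A : Set a} {P : Pred (List A) ℓ} where

  -- Determinism gives each word exactly one run, so negation passes to the state reached, where
  -- acceptance is decidable.
  recognizable-¬ : Recognizable P → Recognizable (λ w → ¬ P w)
  recognizable-¬ (D , q , P⊆D , D⊆P) =
    recognizable-≐ ((_∘ D⊆P) , (_∘ P⊆D))
      (recognizable-family (↔-id _) (λ q w → ¬ Accepts D q w) (DFA.δ D)
        (λ q → ¬? (accepts? D q [])) (λ _ _ → id , id) q)

  recognizable-derivative : Recognizable P → ∀ x → Recognizable (P ∘ (x ∷_))
  recognizable-derivative (D , q , P⊆D , D⊆P) x = D , DFA.δ D q x , P⊆D , D⊆P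

  -- The transitions stay the same; a state becomes final when reading `s` from it leads to
  -- acceptance.
  recognizable-quotientʳ : Recognizable P → ∀ s → Recognizable (λ w → P (w ++ s))
  recognizable-quotientʳ (D , q , P⊆D , D⊆P) s =
    recognizable-≐ (P⊆D , D⊆P)
      (recognizable-family (↔-id _) (λ q w → Accepts D q (w ++ s)) (DFA.δ D)
        (λ q → accepts? D q s) (λ _ _ → id , id) q)

recognizable-quotientˡ : {P : Pred (List A) ℓ} → Recognizable P →
                         ∀ p → Recognizable (λ w → P (p ++ w))
recognizable-quotientˡ P-rec []      = P-rec
recognizable-quotientˡ P-rec (x ∷ p) = recognizable-quotientˡ (recognizable-derivative P-rec x) p

-- Regular versus recognizable

module _ {A : Set a} (M : Automaton A) where
  open Automaton M
  open Inverse finite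

  -- Subset construction. A set of states is stored as its characteristic vector, since a bijection
  -- between functions into `Bool` and some `Fin` would call for extensionality.
  AcceptsFrom : Vec Bool size → Pred (List A) a
  AcceptsFrom V w = ∃[ i ] T (lookup V i) × ∃[ q ] Path M (from i) w q × T (final q)

  Edge : Vec Bool size → A → Pred (Fin size) 0ℓ
  Edge V x j = ∃[ i ] T (lookup V i) × T (edge (from i) x (from j))

  edge? : ∀ V x → Decidable (Edge V x)
  edge? V x j = any? λ i → T? (lookup V i) ×-dec T? (edge (from i) x (from j))

  successors : Vec Bool size → A → Vec Bool size
  successors V x = tabulate (λ j → isYes (edge? V x j))

  acceptsFrom-recognizable : ∀ V → Recognizable (AcceptsFrom V)
  acceptsFrom-recognizable =
    recognizable-family (Vec-finite (↔-sym 2↔Bool) size) AcceptsFrom successors nullable?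
      (λ V x → sound V x , complete V x)
    where
    nullable? : ∀ V → Dec (AcceptsFrom V [])
    nullable? V = map′
      (λ (i , i∈V , f) → i , i∈V , from i , [] , f)
      (λ { (i , i∈V , _ , [] , f) → i , i∈V , f })
      (any? λ i → T? (lookup V i) ×-dec T? (final (from i)))

    sound : ∀ V x {w} → AcceptsFrom V (x ∷ w) → AcceptsFrom (successors V x) w
    sound V x {w} (i , i∈V , q , _∷_ {q = r} e path , f) =
      to r ,
      subst T (sym (lookup∘tabulate _ (to r)))
        (fromWitness (i , i∈V , subst (λ r → T (edge (from i) x r)) (sym (strictlyInverseʳ r)) e)) ,
      q , subst (λ r → Path M r w q) (sym (strictlyInverseʳ r)) path , f

    complete : ∀ V x {w} → AcceptsFrom (successors V x) w → AcceptsFrom V (x ∷ w)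
    complete V x (j , j∈W , q , path , f)
      with i , i∈V , e ← toWitness {a? = edge? V x j} (subst T (lookup∘tabulate _ j) j∈W) =
      i , i∈V , q , e ∷ path , f

  language-recognizable : Recognizable (Language M)
  language-recognizable = recognizable-≐
    ((λ {w} (p , q , ip , path , f) →
        to p ,
        subst T (sym (trans (lookup∘tabulate _ (to p)) (cong initial (strictlyInverseʳ p)))) ip ,
        q , subst (λ p → Path M p w q) (sym (strictlyInverseʳ p)) path , f) ,
     (λ (i , i∈V , q , path , f) →
        from i , q , subst T (lookup∘tabulate _ i) i∈V , path , f))
    (acceptsFrom-recognizable (tabulate (initial ∘ from)))

regular⇒recognizable : {P : Pred (List A) ℓ} → Regular P → Recognizable P
regular⇒recognizable (M , P≐M) = recognizable-≐ P≐M (language-recognizable M)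

recognizable⇒regular : {P : Pred (List A) ℓ} → Recognizable P → Regular P
recognizable⇒regular {A = A} {P = P} (D , q₀ , P≐D) = M , ≐-trans P≐D D≐M
  where
  open DFA D

  M : Automaton A
  M = record
    { State   = Fin size
    ; size    = size
    ; finite  = ↔-id _
    ; initial = λ q → isYes (q Fin.≟ q₀)
    ; final   = final
    ; edge    = λ p x q → isYes (δ p x Fin.≟ q)
    }

  run : ∀ q w → Accepts D q w → ∃[ r ] Path M q w r × T (final r)
  run q []      f   = q , [] , f
  run q (x ∷ w) acc with r , path , f ← run (δ q x) w acc = r , fromWitness refl ∷ path , f

  accepting : ∀ {q w r} → Path M q w r → T (final r) → Accepts D q w
  accepting []         f = f
  accepting {q} (_∷_ {q = r} {x = x} {w = w} e path) f =
    subst (λ r → Accepts D r w) (sym (toWitness {a? = δ q x Fin.≟ r} e)) (accepting path f)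

  D≐M : Accepts D q₀ ≐ Language M
  D≐M =
    (λ {w} acc → let r , path , f = run q₀ w acc in q₀ , r , fromWitness refl , path , f) ,
    (λ {w} (p , r , ip , path , f) →
      subst (λ p → Accepts D p w) (toWitness {a? = p Fin.≟ q₀} ip) (accepting path f))

-- Longest common factors

module _ {A : Set a} (_≟_ : DecidableEquality A) where

  -- A prefix of `x ∷ w` is empty or is `x` followed by a prefix of `w`; the recursion moves the
  -- letter `x` into the predicate.
  ∃-prefix? : {Q : Pred (List A) ℓ} → Decidable Q → ∀ w → Dec (∃[ g ] Prefix _≡_ g w × Q g)
  ∃-prefix? Q? []      = map′ (λ q → [] , [] , q) (λ { (_ , [] , q) → q }) (Q? [])
  ∃-prefix? Q? (x ∷ w) = map′
    (λ { (inj₁ q) → [] , [] , q ; (inj₂ (g , pre , q)) → x ∷ g , refl ∷ pre , q })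
    (λ { (_ , [] , q) → inj₁ q ; (_ , refl ∷ pre , q) → inj₂ (_ , pre , q) })
    (Q? [] ⊎-dec ∃-prefix? (Q? ∘ (x ∷_)) w)

  ∃-factor? : {Q : Pred (List A) ℓ} → Decidable Q → ∀ w → Dec (∃[ g ] Factor g w × Q g)
  ∃-factor? Q? []      = map′ (λ q → [] , here [] , q) (λ { (_ , here [] , q) → q }) (Q? [])
  ∃-factor? Q? (x ∷ w) = map′
    (λ { (inj₁ (g , pre , q)) → g , here pre , q ; (inj₂ (g , fac , q)) → g , there fac , q })
    (λ { (g , here pre , q) → inj₁ (g , pre , q) ; (g , there fac , q) → inj₂ (g , fac , q) })
    (∃-prefix? Q? (x ∷ w) ⊎-dec ∃-factor? Q? w)

  -- Replace the common factor by a longer one as long as such a factor exists. The search is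
  -- decidable, and `length w` bounds the number of replacements.
  longestCommonFactor : ∀ w w′ {f} → CommonFactor w w′ f → ∃ (LongestCommonFactor w w′)
  longestCommonFactor w w′ {f} = extend (length w) (m≤n+m (length w) (length f))
    where
    extend : ∀ fuel {f} → length w ≤ length f + fuel → CommonFactor w w′ f →
             ∃ (LongestCommonFactor w w′)
    -- Without fuel `f` is at least as long as `w`, so no factor of `w` can exceed it.
    extend zero {f} w≤f common = f , common , λ g (g⊑w , _) →
      ≤-trans (length-mono g⊑w) (subst (length w ≤_) (+-identityʳ (length f)) w≤f)
    extend (suc fuel) {f} w≤f common
      with ∃-factor? (λ g → infix? _≟_ g w′ ×-dec (suc (length f) ≤? length g)) w
    ... | no  ∄longer = f , common , λ g (g⊑w , g⊑w′) →
      ≤-pred (≰⇒> λ f<g → ∄longer (g , g⊑w , g⊑w′ , f<g))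
    -- The gain of at least one letter pays for the unit of fuel spent.
    ... | yes (g , g⊑w , g⊑w′ , f<g) = extend fuel
      (≤-trans w≤f (≤-trans (≤-reflexive (+-suc (length f) fuel)) (+-monoˡ-≤ fuel f<g)))
      (g⊑w , g⊑w′)

++-factor : ∀ (p f s : List A) → Factor f (p ++ f ++ s)
++-factor p f s = fromView (MkView p (≡⇒Pointwise-≡ refl) s)

factor-++ : ∀ {f w : List A} → Factor f w → ∃[ p ] ∃[ s ] w ≡ p ++ f ++ s
factor-++ f⊑w with MkView p f≋g s ← toView f⊑w with refl ← Pointwise-≡⇒≡ f≋g = p , s , refl

-- The two copies of `f` account for exactly `2 * length f`, so the subtraction does not truncate
-- and leaves the total length of the four contexts.
length-contexts : ∀ (p s p′ s′ f : List A) →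
  length (p ++ f ++ s) + length (p′ ++ f ++ s′) ∸ 2 * length f ≡
  (length p + length s) + (length p′ + length s′)
length-contexts p s p′ s′ f = trans (cong (_∸ 2 * length f) sum) (m+n∸n≡m _ (2 * length f))
  where
  length₃ : ∀ (p s : List _) → length (p ++ f ++ s) ≡ length p + (length f + length s)
  length₃ p s = trans (length-++ p) (cong (length p +_) (length-++ f))

  sum : length (p ++ f ++ s) + length (p′ ++ f ++ s′) ≡
        (length p + length s) + (length p′ + length s′) + 2 * length f
  sum = trans (cong₂ _+_ (length₃ p s) (length₃ p′ s′))
    (solve 5 (λ p s p′ s′ f → (p :+ (f :+ s)) :+ (p′ :+ (f :+ s′))
                            := ((p :+ s) :+ (p′ :+ s′)) :+ con 2 :* f) refl
      (length p) (length s) (length p′) (length s′) (length f))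
    where open +-*-Solver

-- Bounded contexts of an unknown factor

Within : {A : Set a} → ℕ → (List A → Set ℓ) → Set (a ⊔ ℓ)
Within k P = ∃[ p ] length p ≤ k × P p

module _ {A : Set a} {n : ℕ} (A↔n : A ↔ Fin n) where
  open Inverse A↔n

  _≟_ : DecidableEquality A
  _≟_ = Fin.inj⇒≟ (↔⇒↣ A↔n)

  recognizable-∃-Fin : ∀ {m} {P : Fin m → Pred (List A) ℓ} →
                       (∀ i → Recognizable (P i)) → Recognizable (λ w → ∃[ i ] P i w)
  recognizable-∃-Fin {m = zero}  rec =
    recognizable-≐ ((λ { (() , _) }) , ⊥-elim) (recognizable-const (no id))
  recognizable-∃-Fin {m = suc m} rec =
    recognizable-≐
      ((λ { (zero , p) → inj₁ p ; (suc i , p) → inj₂ (i , p) }) ,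
       (λ { (inj₁ p) → zero , p ; (inj₂ (i , p)) → suc i , p }))
      (recognizable-⊎ (rec zero) (recognizable-∃-Fin (rec ∘ suc)))

  recognizable-∃-letter : {P : A → Pred (List A) ℓ} →
                          (∀ x → Recognizable (P x)) → Recognizable (λ w → ∃[ x ] P x w)
  recognizable-∃-letter {P = P} rec =
    recognizable-≐
      ((λ {w} (x , p) → to x , subst (λ x → P x w) (sym (strictlyInverseʳ x)) p) ,
       (λ (i , p) → from i , p))
      (recognizable-∃-Fin (rec ∘ from))

  -- A bounded quantifier over words is a finite union: the word is empty, or it is one of finitely
  -- many letters followed by a word with a smaller bound.
  recognizable-Within : ∀ k {P : List A → Pred (List A) ℓ} → (∀ p → Recognizable (P p)) →
                        Recognizable (λ w → Within k (λ p → P p w))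
  recognizable-Within zero    rec =
    recognizable-≐ ((λ { ([] , _ , p) → p }) , (λ p → [] , z≤n , p)) (rec [])
  recognizable-Within (suc k) rec =
    recognizable-≐
      ((λ { ([] , _ , p) → inj₁ p ; (x ∷ v , s≤s v≤k , p) → inj₂ (x , v , v≤k , p) }) ,
       (λ { (inj₁ p) → [] , z≤n , p ; (inj₂ (x , v , v≤k , p)) → x ∷ v , s≤s v≤k , p }))
      (recognizable-⊎ (rec [])
        (recognizable-∃-letter λ x → recognizable-Within k (rec ∘ (x ∷_))))

  -- The states are: nothing read, a wrong first letter read, and those of P;
  -- w ≢ w and w ≡ w stand for ⊥ and ⊤ in the universe of A.
  recognizable-∷ : {P : Pred (List A) ℓ} → Recognizable P → ∀ x →
                   Recognizable (λ w → ∃[ f ] w ≡ x ∷ f × P f)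
  recognizable-∷ (D , q , P⊆D , D⊆P) x =
    recognizable-≐
      ((λ (f , w≡ , p) → f , w≡ , P⊆D p) , (λ (f , w≡ , p) → f , w≡ , D⊆P p))
      (recognizable-family (↔-id _) L δ nullable? derivative zero)
    where
    L : Fin (2 + DFA.size D) → Pred (List A) a
    L zero          w = ∃[ f ] w ≡ x ∷ f × Accepts D q f
    L (suc zero)    w = w ≢ w
    L (suc (suc r)) w = w ≡ w × Accepts D r w

    δ : Fin (2 + DFA.size D) → A → Fin (2 + DFA.size D)
    δ zero          y with x ≟ y
    ... | yes _ = suc (suc q)
    ... | no  _ = suc zero
    δ (suc zero)    y = suc zero
    δ (suc (suc r)) y = suc (suc (DFA.δ D r y))

    nullable? : ∀ r → Dec (L r [])
    nullable? zero          = no λ ()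
    nullable? (suc zero)    = no λ []≢[] → []≢[] refl
    nullable? (suc (suc r)) = yes refl ×-dec accepts? D r []

    derivative : ∀ r y → (L r ∘ (y ∷_)) ≐ L (δ r y)
    derivative zero y with x ≟ y
    ... | yes refl = (λ { (_ , refl , acc) → refl , acc }) , (λ (_ , acc) → _ , refl , acc)
    ... | no  x≢y  = (λ { (_ , refl , _) → contradiction refl x≢y }) ,
                     (λ w≢w → contradiction refl w≢w)
    derivative (suc zero)    y = (λ ≢ → contradiction refl ≢) , (λ ≢ → contradiction refl ≢)
    derivative (suc (suc r)) y = (λ (_ , acc) → refl , acc) , (λ (_ , acc) → refl , acc)

  recognizable-++ˡ : ∀ p {P : Pred (List A) ℓ} → Recognizable P →
                     Recognizable (λ w → ∃[ f ] w ≡ p ++ f × P f)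
  recognizable-++ˡ []      rec = recognizable-≐ ((λ { (_ , refl , p) → p }) , (λ p → _ , refl , p)) rec
  recognizable-++ˡ (x ∷ p) rec =
    recognizable-≐
      ((λ { (f , refl , Pf) → p ++ f , refl , f , refl , Pf }) ,
       (λ { (_ , refl , f , refl , Pf) → f , refl , Pf }))
      (recognizable-∷ (recognizable-++ˡ p rec) x)

  -- The Boolean records whether the word read so far lies in P x.
  recognizable-∷ʳ : {P : Pred (List A) ℓ} → Recognizable P → ∀ x →
                    Recognizable (λ w → ∃[ f ] w ≡ f ∷ʳ x × P f)
  recognizable-∷ʳ (D , q , P⊆D , D⊆P) x =
    recognizable-≐
      ((λ (f , w≡ , p) → inj₁ (f , w≡ , P⊆D p)) ,
       (λ { (inj₁ (f , w≡ , p)) → f , w≡ , D⊆P p ; (inj₂ (() , _)) }))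
      (recognizable-family (×-finite (↔-id _) (↔-sym 2↔Bool)) L δ nullable?
        (λ s y → sound s y , complete s y) (q , false))
    where
    S : Set
    S = Fin (DFA.size D) × Bool

    L : S → Pred (List A) a
    L (r , b) w = (∃[ f ] w ≡ f ∷ʳ x × Accepts D r f) ⊎ (T b × w ≡ [])

    last? : ∀ r y → Dec (x ≡ y × Accepts D r [])
    last? r y = x ≟ y ×-dec accepts? D r []

    δ : S → A → S
    δ (r , _) y = DFA.δ D r y , isYes (last? r y)

    nullable? : ∀ s → Dec (L s [])
    nullable? (r , b) = map′
      (λ t → inj₂ (t , refl))
      (λ { (inj₁ ([] , () , _)) ; (inj₁ (_ ∷ _ , () , _)) ; (inj₂ (t , _)) → t })
      (T? b)

    sound : ∀ s y {w} → L s (y ∷ w) → L (δ s y) w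
    sound (r , b) y (inj₁ ([]    , refl , acc)) = inj₂ (fromWitness {a? = last? r y} (refl , acc) , refl)
    sound (r , b) y (inj₁ (_ ∷ f , refl , acc)) = inj₁ (f , refl , acc)

    complete : ∀ s y {w} → L (δ s y) w → L s (y ∷ w)
    complete (r , b) y (inj₁ (f , refl , acc)) = inj₁ (y ∷ f , refl , acc)
    complete (r , b) y (inj₂ (t , refl)) with refl , acc ← toWitness {a? = last? r y} t =
      inj₁ ([] , refl , acc)

  recognizable-++ʳ : ∀ s {P : Pred (List A) ℓ} → Recognizable P →
                     Recognizable (λ w → ∃[ f ] w ≡ f ++ s × P f)
  recognizable-++ʳ []      {P} rec =
    recognizable-≐
      ((λ { (f , refl , p) → subst P (sym (List.++-identityʳ f)) p }) ,
       (λ {w} p → w , sym (List.++-identityʳ w) , p)) rec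
  recognizable-++ʳ (x ∷ s) rec =
    recognizable-≐
      ((λ { (f , refl , p) → f ∷ʳ x , sym (∷ʳ-++ f x s) , f , refl , p }) ,
       (λ { (_ , refl , f , refl , p) → f , ∷ʳ-++ f x s , p }))
      -- The letter `x` is appended before `s`, because `f ++ x ∷ s` is `(f ∷ʳ x) ++ s`.
      (recognizable-++ʳ s (recognizable-∷ʳ rec x))

  -- Word equations with one unknown factor

  -- The Boolean turns false at the first mismatch with the queue.
  recognizable-queue : ∀ s s′ {m} (u : Vec A (suc m)) →
                       Recognizable (λ f → toList u ++ f ++ s ≡ f ++ s′)
  recognizable-queue s s′ {m} u =
    recognizable-≐ ((λ eq → _ , eq) , proj₂)
      (recognizable-family (×-finite (↔-sym 2↔Bool) (Vec-finite A↔n (suc m))) L δ nullable?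
        (λ S y → sound S y , complete S y) (true , u))
    where
    S : Set a
    S = Bool × Vec A (suc m)

    L : S → Pred (List A) a
    L (b , u) f = T b × toList u ++ f ++ s ≡ f ++ s′

    match? : ∀ b x y → Dec (T b × x ≡ y)
    match? b x y = T? b ×-dec x ≟ y

    δ : S → A → S
    δ (b , x ∷ u) y = isYes (match? b x y) , u Vec.∷ʳ y

    nullable? : ∀ S → Dec (L S [])
    nullable? (b , u) = T? b ×-dec List.≡-dec _≟_ (toList u ++ s) s′

    toList-∷ʳ-++ : ∀ {m} (u : Vec A m) y w → toList (u Vec.∷ʳ y) ++ w ≡ toList u ++ y ∷ w
    toList-∷ʳ-++ u y w = trans (cong (_++ w) (toList-∷ʳ y u)) (∷ʳ-++ (toList u) y w)

    -- The equation `x ∷ u ++ y ∷ f ++ s ≡ y ∷ f ++ s′` forces `x ≡ y`, and its tail is the same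
    -- kind of equation for `f`, with queue `u ∷ʳ y`.
    sound : ∀ S y {f} → L S (y ∷ f) → L (δ S y) f
    sound (b , x ∷ u) y (t , eq) =
      fromWitness {a? = match? b x y} (t , ∷-injectiveˡ eq) ,
      trans (toList-∷ʳ-++ u y _) (∷-injectiveʳ eq)

    complete : ∀ S y {f} → L (δ S y) f → L S (y ∷ f)
    complete (b , x ∷ u) y (t , eq) with t′ , refl ← toWitness {a? = match? b x y} t =
      t′ , cong (x ∷_) (trans (sym (toList-∷ʳ-++ u y _)) eq)

  -- A nonempty `u` serves as the initial queue. If `u` is empty, `f` cancels and the condition
  -- `s ≡ s′` is independent of `f`.
  recognizable-shift : ∀ u s s′ → Recognizable (λ f → u ++ f ++ s ≡ f ++ s′)
  recognizable-shift []      s s′ =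
    recognizable-≐ ((λ {f} → List.++-cancelˡ f s s′) , (λ {f} → cong (f ++_)))
      (recognizable-const (List.≡-dec _≟_ s s′))
  recognizable-shift (x ∷ u) s s′ =
    subst (λ u → Recognizable (λ f → u ++ f ++ s ≡ f ++ s′)) (toList∘fromList (x ∷ u))
      (recognizable-queue s s′ (fromList (x ∷ u)))

  -- Comparing `p` and `p′` letter by letter either meets a mismatch or exhausts one of them; the
  -- latter leaves a shift equation, possibly with its sides exchanged.
  recognizable-≡ : ∀ p s p′ s′ → Recognizable (λ f → p ++ f ++ s ≡ p′ ++ f ++ s′)
  recognizable-≡ p       s []        s′ = recognizable-shift p s s′
  recognizable-≡ []      s p′        s′ =
    recognizable-≐ (sym , sym) (recognizable-shift p′ s′ s)
  recognizable-≡ (x ∷ p) s (x′ ∷ p′) s′ =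
    recognizable-≐
      (∷-injective , uncurry (cong₂ _∷_))
      (recognizable-× (recognizable-const (x ≟ x′)) (recognizable-≡ p s p′ s′))

  -- The image of a language under `𝓕̲ k`

  module _ (k : ℕ) (X : Pred (List A) ℓ) where

    -- The decomposition of `y` is split in two, first removing `p′` and then `s′`, to match the
    -- languages of `recognizable-++ˡ` and `recognizable-++ʳ`. The length bound is constant in `y`.
    Rewritten : (p s p′ s′ : List A) → Pred (List A) (a ⊔ ℓ)
    Rewritten p s p′ s′ y =
      (length p + length s) + (length p′ + length s′) ≤ k ×
      ∃[ v ] y ≡ p′ ++ v × ∃[ f ] v ≡ f ++ s′ ×
        (X (p ++ f ++ s) × p ++ f ++ s ≢ p′ ++ f ++ s′)

    -- The total bound `k` on the contexts also bounds each of them separately, which turns the four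
    -- quantifiers into bounded ones.
    image-𝓕̲ : image (𝓕̲ k) X ≐
      (λ y → Within k λ p → Within k λ s → Within k λ p′ → Within k λ s′ → Rewritten p s p′ s′ y)
    image-𝓕̲ = decompose , compose
      where
      decompose : ∀ {y} → image (𝓕̲ k) X y → Within k λ p → Within k λ s →
                  Within k λ p′ → Within k λ s′ → Rewritten p s p′ s′ y
      decompose (x , x∈X , (f , ((f⊑x , f⊑y) , _) , d≤k) , x≢y)
        with p , s , refl ← factor-++ f⊑x | p′ , s′ , refl ← factor-++ f⊑y =
        p  , ≤-trans (≤-trans (m≤m+n _ _) (m≤m+n _ _)) sum≤k ,
        s  , ≤-trans (≤-trans (m≤n+m _ (length p)) (m≤m+n _ _)) sum≤k ,
        p′ , ≤-trans (≤-trans (m≤m+n _ _) (m≤n+m _ (length p + length s))) sum≤k ,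
        s′ , ≤-trans (≤-trans (m≤n+m _ (length p′)) (m≤n+m _ (length p + length s))) sum≤k ,
        sum≤k , _ , refl , f , refl , x∈X , x≢y
        where
        sum≤k : (length p + length s) + (length p′ + length s′) ≤ k
        sum≤k = subst (_≤ k) (length-contexts p s p′ s′ f) d≤k

      compose : ∀ {y} → (Within k λ p → Within k λ s → Within k λ p′ → Within k λ s′ →
                  Rewritten p s p′ s′ y) → image (𝓕̲ k) X y
      compose (p , _ , s , _ , p′ , _ , s′ , _ , sum≤k , _ , refl , f , refl , x∈X , x≢y)
        -- `f` is an arbitrary common factor here, whereas `𝓕 k` asks for a longest one.
        with g , common , longest ←
          longestCommonFactor _≟_ _ _ (++-factor p f s , ++-factor p′ f s′) =
        p ++ f ++ s , x∈X , (g , (common , longest) , d≤k) , x≢y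
        where
        f≤g : length f ≤ length g
        f≤g = longest f (++-factor p f s , ++-factor p′ f s′)

        d≤k : length (p ++ f ++ s) + length (p′ ++ f ++ s′) ∸ 2 * length g ≤ k
        -- Passing from `f` to the longer `g` can only lower the difference, and its value at `f` is
        -- the total length of the contexts.
        d≤k = ≤-trans
          (∸-monoʳ-≤ (length (p ++ f ++ s) + length (p′ ++ f ++ s′)) (*-monoʳ-≤ 2 f≤g))
          (≤-trans (≤-reflexive (length-contexts p s p′ s′ f)) sum≤k)

    recognizable-image : Recognizable X → Recognizable (image (𝓕̲ k) X)
    recognizable-image X-rec = recognizable-≐ image-𝓕̲
      (recognizable-Within k λ p → recognizable-Within k λ s →
       recognizable-Within k λ p′ → recognizable-Within k λ s′ →
       recognizable-× (recognizable-const (_ ≤? k))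
         (recognizable-++ˡ p′ (recognizable-++ʳ s′
           (recognizable-×
             (recognizable-quotientʳ (recognizable-quotientˡ X-rec p) s)
             (recognizable-¬ (recognizable-≡ p s p′ s′))))))

proposition4p15 : {a ℓ : Level} (A : Set a) (n : ℕ) → A ↔ Fin n → 2 ≤ n →
    (k : ℕ) → 1 ≤ k →
    (X : Pred (List A) ℓ) → Regular X → Regular (image (𝓕̲ k) X)
proposition4p15 A n A↔n _ k _ X X-regular =
  recognizable⇒regular (recognizable-image A↔n k X (regular⇒recognizable X-regular))
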